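{- Let $r\ge 3$ and let $\mathcal{H}$ be an $r$-uniform $r$-partite linear hypergraph which contains no rainbow cycles of length three or four. Then $\mathcal{H}$ is $\mathcal{G}_r(8r-13,8)$-free.
   Context: A hypergraph is linear if any two distinct edges share at most one vertex. An $r$-uniform hypergraph is $r$-partite if its vertex set is partitioned into $r$ parts $V_1,\dots,V_r$ such that every edge contains exactly one vertex of each part. A cycle of length $k$ is a sequence $v_1,A_1,\dots,v_k,A_k,v_1$ of distinct vertices and distinct edges with $v_i,v_{i+1}\in A_i$ ($1\le i\le k-1$) and $v_k,v_1\in A_k$; it is a rainbow $k$-cycle if $v_1,\dots,v_k$ lie in pairwise different parts. An $r$-uniform hypergraph is $\mathcal{G}_r(v,e)$-free if the union of any $e$ distinct edges has at least $v+1$ vertices. -}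

module Defs where

open import Data.Nat using (ℕ; zero; suc)
open import Data.Fin using (Fin; zero; suc; inject₁; fromℕ; _≟_)
open import Data.Fin.Properties using (any?)
open import Data.List using (List; length; filter)
open import Data.Empty using (⊥)
open import Data.Product using (Σ; ∃; _×_; _,_)
open import Relation.Binary.PropositionalEquality using (_≡_; _≢_)
open import Relation.Nullary using (Dec)
open import Function.Definitions using (Injective)
import Data.List as L

-- An r-partite r-uniform hypergraph on vertex set Fin n with m edges.
-- part v : the part V_i containing vertex v.
-- edge e k : the unique vertex of edge e lying in part k.
record PartiteHypergraph (r : ℕ) : Set where
  field
    n     : ℕ
    m     : ℕ
    part  : Fin n → Fin r
    edge  : Fin m → Fin r → Fin n
    edge-part : ∀ e k → part (edge e k) ≡ k
    edge-distinct : ∀ e f → (∀ k → edge e k ≡ edge f k) → e ≡ f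

open PartiteHypergraph public

_∈ₑ_ : ∀ {r} {H : PartiteHypergraph r} → Fin (n H) → Fin (m H) → Set
_∈ₑ_ {H = H} v e = ∃ λ k → edge H e k ≡ v

Linear : ∀ {r} → PartiteHypergraph r → Set
Linear H = ∀ (e f : Fin (m H)) → e ≢ f →
  ∀ (u w : Fin (n H)) → _∈ₑ_ {H = H} u e → _∈ₑ_ {H = H} u f →
  _∈ₑ_ {H = H} w e → _∈ₑ_ {H = H} w f → u ≡ w

-- A cycle of length (suc k): v₀ A₀ v₁ A₁ … v_k A_k v₀, with distinct vertices
-- and distinct edges, v_i, v_{i+1} ∈ A_i (i < k) and v_k, v₀ ∈ A_k.
-- Rainbow: the vertices v_i lie in pairwise different parts.
record RainbowCycle {r} (H : PartiteHypergraph r) (k : ℕ) : Set where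
  field
    vtx : Fin (suc k) → Fin (n H)
    edg : Fin (suc k) → Fin (m H)
    vtx-distinct : Injective _≡_ _≡_ vtx
    edg-distinct : Injective _≡_ _≡_ edg
    step₁ : ∀ (i : Fin k) → _∈ₑ_ {H = H} (vtx (inject₁ i)) (edg (inject₁ i))
    step₂ : ∀ (i : Fin k) → _∈ₑ_ {H = H} (vtx (suc i)) (edg (inject₁ i))
    close₁ : _∈ₑ_ {H = H} (vtx (fromℕ k)) (edg (fromℕ k))
    close₂ : _∈ₑ_ {H = H} (vtx zero) (edg (fromℕ k))
    rainbow : Injective _≡_ _≡_ (λ i → part H (vtx i))

HasRainbowCycleOfLength : ∀ {r} → PartiteHypergraph r → ℕ → Set
HasRainbowCycleOfLength H zero = ⊥
HasRainbowCycleOfLength H (suc k) = RainbowCycle H k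

unionSize : ∀ {r} (H : PartiteHypergraph r) {t : ℕ} → (Fin t → Fin (m H)) → ℕ
unionSize H {t} S =
  length (filter (λ v → any? (λ j → any? (λ k → edge H (S j) k ≟ v)))
                 (L.allFin (n H)))

GFree : ∀ {r} → PartiteHypergraph r → ℕ → ℕ → Set
GFree H v e = ∀ (S : Fin e → Fin (m H)) → Injective _≡_ _≡_ S →
  Data.Nat._<_ v (unionSize H S)
  where import Data.Nat

{-# OPTIONS --safe #-}

-- Call two edges of H adjacent with colour c if they share their vertex in part c. Deleting
-- an edge x from a set L lowers |L| r − |⋃ L| by the number deg L x of colours at x, so it
-- suffices to delete 8 edges with degrees adding up to at most 12. The neighbours of x in
-- different colours are pairwise non-adjacent (otherwise there is a rainbow triangle), hence
-- the minimum degree of L is at most |L| / 2. This bounds the sum by 2, 4, 6, 9 for 3, 4, 5, 6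
-- edges. The bounds 10 and 12 for 7 and 8 edges follow by further deletions (a seventh edge
-- with two neighbours in a K₃,₃ is ruled out separately) unless all degrees are at least 3. In that case
-- all colour classes have at most two elements, no degree exceeds 3 (four neighbours and three
-- further edges would yield a rainbow quadrangle), and there is a quadrangle, whose deletion
-- costs only 3 + 2 + 2 + 1.

module Submission where

open import Defs
open import Data.Nat using (ℕ; zero; suc; _+_; _*_; _∸_; _≤_; _<_; z≤n; s≤s; _≤?_)
open import Data.Nat.Properties
  using (≤-refl; ≤-trans; ≤-reflexive; ≤-pred; ≰⇒>; <⇒≱; +-comm; +-assoc;
         +-mono-≤; +-monoˡ-≤; +-monoʳ-≤; +-cancelˡ-≤; *-monoˡ-≤; *-monoʳ-≤; +-∸-assoc; m≤n+o⇒m∸n≤o;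
         module ≤-Reasoning)
open import Data.Nat.Tactic.RingSolver using (solve-∀)
open import Data.Empty using (⊥; ⊥-elim)
open import Data.Fin using (Fin; zero; suc; inject₁; inject≤; fromℕ; _≟_)
open import Data.Fin.Properties using (any?; all?; pigeonhole; <⇒≢; inject≤-injective)
open import Data.List using (List; []; _∷_; _++_; length; filter; map; tabulate; allFin; lookup)
open import Data.List.Properties using (length-tabulate; length-++; length-map; filter-notAll)
open import Data.List.Membership.Propositional using (_∈_; _∉_; find; lose)
open import Data.List.Membership.Propositional.Properties
  using (∈-filter⁺; ∈-filter⁻; ∈-++⁺ˡ; ∈-++⁺ʳ; ∈-++⁻; ∈-map⁻; ∈-tabulate⁻; ∈-lookup; ∈-allFin)
open import Data.List.Relation.Binary.Disjoint.Propositional using (Disjoint)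
open import Data.List.Relation.Binary.Subset.Propositional using (_⊆_)
open import Data.List.Relation.Binary.Subset.Propositional.Properties using (∈-∷⁺ʳ)
open import Data.List.Relation.Unary.All using (All; []; _∷_)
import Data.List.Relation.Unary.All as All
open import Data.List.Relation.Unary.All.Properties using (¬Any⇒All¬; All¬⇒¬Any)
open import Data.List.Relation.Unary.AllPairs using (AllPairs; []; _∷_)
open import Data.List.Relation.Unary.Any using (Any; here; there)
import Data.List.Relation.Unary.Any as Any
open import Data.List.Relation.Unary.Unique.Propositional using (Unique)
import Data.List.Relation.Unary.Unique.Propositional.Properties as Uniqueₚ
open import Data.Product using (∃; _×_; _,_; proj₁; proj₂)
open import Data.Sum using (_⊎_; inj₁; inj₂)
open import Function using (_∘_; id)
open import Function.Definitions using (Injective)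
open import Relation.Binary.Definitions using (DecidableEquality)
open import Relation.Binary.PropositionalEquality
  using (_≡_; _≢_; refl; sym; trans; cong; subst; ≢-sym)
open import Relation.Nullary using (¬_; Dec; yes; no; contradiction)
open import Relation.Nullary.Decidable using (¬?; _×-dec_; _⊎-dec_; _→-dec_; from-yes)
open import Relation.Unary using (Decidable; ∁)

-- Duplicate-free lists and small finite checks

private
  variable
    A : Set
    k : ℕ

∉⇒Unique-∷ : {x : A} {xs : List A} → x ∉ xs → Unique xs → Unique (x ∷ xs)
∉⇒Unique-∷ x∉ xs! = ¬Any⇒All¬ _ x∉ ∷ xs!

Unique-lookup-injective : {xs : List A} → Unique xs → Injective _≡_ _≡_ (lookup xs)
Unique-lookup-injective (_ ∷ _)  {zero}  {zero}  _  = refl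
Unique-lookup-injective (x∉ ∷ _) {zero}  {suc j} eq =
  contradiction (subst (_∈ _) (sym eq) (∈-lookup j)) (All¬⇒¬Any x∉)
Unique-lookup-injective (x∉ ∷ _) {suc i} {zero}  eq =
  contradiction (subst (_∈ _) eq (∈-lookup i)) (All¬⇒¬Any x∉)
Unique-lookup-injective (_ ∷ xs!) {suc i} {suc j} eq = cong suc (Unique-lookup-injective xs! eq)

-- Turns a short list into a family indexed by `Fin k`; surplus indices take the default value, so
-- the family may repeat itself and leave the list.
covering : A → (xs : List A) → length xs ≤ k →
  ∃ λ (f : Fin k → A) → ∀ {x} → x ∈ xs → ∃ λ j → f j ≡ x
covering d []       _       = (λ _ → d) , λ ()
covering d (x ∷ xs) (s≤s ≤k) with f , onto ← covering d xs ≤k =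
  (λ { zero → x ; (suc j) → f j }) ,
  λ { (here refl) → zero , refl ; (there ∈xs) → let j , eq = onto ∈xs in suc j , eq }

module _ (_≟ᴬ_ : DecidableEquality A) where

  open import Data.List.Membership.DecPropositional _≟ᴬ_ using (_∈?_)

  Unique-⊆-length : {xs ys : List A} → Unique xs → xs ⊆ ys → length xs ≤ length ys
  Unique-⊆-length [] _ = z≤n
  Unique-⊆-length {x ∷ xs} {ys} (x∉ ∷ xs!) sub =
    ≤-trans (s≤s (Unique-⊆-length xs! λ y∈ →
               ∈-filter⁺ (λ y → ¬? (y ≟ᴬ x)) (sub (there y∈))
                 λ { refl → All¬⇒¬Any x∉ y∈ }))
            (filter-notAll _ ys (Any.map (λ x≡y y≢x → y≢x (sym x≡y)) (sub (here refl))))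

  outside : List A → List A → List A
  outside xs = filter (λ y → ¬? (y ∈? xs))

  outside⊆ : ∀ xs {ys} → outside xs ys ⊆ ys
  outside⊆ xs = proj₁ ∘ ∈-filter⁻ _

  outside-∉ : ∀ xs {ys x} → x ∈ xs → x ∉ outside xs ys
  outside-∉ xs {ys} x∈ x∈o = proj₂ (∈-filter⁻ _ {xs = ys} x∈o) x∈

  ∈-outside : ∀ xs {ys x} → x ∈ ys → x ∉ xs → x ∈ outside xs ys
  ∈-outside xs = ∈-filter⁺ _

  ⊆-++-outside : ∀ xs {ys} → ys ⊆ xs ++ outside xs ys
  ⊆-++-outside xs {_} {y} y∈ with y ∈? xs
  ... | yes ∈xs = ∈-++⁺ˡ ∈xs
  ... | no  ∉xs = ∈-++⁺ʳ xs (∈-outside xs y∈ ∉xs)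

  outside-length : ∀ {xs ys} → Unique xs → xs ⊆ ys → Unique ys →
    length xs + length (outside xs ys) ≤ length ys
  outside-length {xs} {ys} xs! sub ys! = ≤-trans
    (≤-reflexive (sym (length-++ xs)))
    (Unique-⊆-length
      (Uniqueₚ.++⁺ xs! (Uniqueₚ.filter⁺ _ ys!) (λ (∈xs , ∈o) → outside-∉ xs {ys} ∈xs ∈o))
      λ z∈ → case-++ (∈-++⁻ xs z∈))
    where
    case-++ : ∀ {z} → z ∈ xs ⊎ z ∈ outside xs ys → z ∈ ys
    case-++ (inj₁ ∈xs) = sub ∈xs
    case-++ (inj₂ ∈o)  = outside⊆ xs ∈o

abstract
  complement : (s t : Fin 3) → s ≢ t → ∃ λ u → s ≢ u × t ≢ u × (∀ j → j ≢ u → j ≡ s ⊎ j ≡ t)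
  complement = from-yes (all? λ (s : Fin 3) → all? λ (t : Fin 3) → ¬? (s ≟ t) →-dec
    any? λ u → ¬? (s ≟ u) ×-dec ¬? (t ≟ u) ×-dec
      all? λ j → ¬? (j ≟ u) →-dec ((j ≟ s) ⊎-dec (j ≟ t)))

  -- Exhaustive check; later `p` and `q` are the two spokes of a four-spoke star left over by `i`
  -- and `j`.
  other-two : (i j : Fin 4) → ∃ λ p → ∃ λ q → (i ≢ p × i ≢ q) × (j ≢ p × j ≢ q) × p ≢ q
  other-two = from-yes (all? λ (i : Fin 4) → all? λ (j : Fin 4) → any? λ p → any? λ q →
    (¬? (i ≟ p) ×-dec ¬? (i ≟ q)) ×-dec (¬? (j ≟ p) ×-dec ¬? (j ≟ q)) ×-dec ¬? (p ≟ q))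

-- Coloured adjacency and forbidden cycles

module Conflicts {r : ℕ} (H : PartiteHypergraph r) (linear : Linear H)
  (no3 : ¬ HasRainbowCycleOfLength H 3) (no4 : ¬ HasRainbowCycleOfLength H 4) where

  private
    E = Fin (m H)
    V = Fin (n H)

    variable
      L L′ R : List E
      a b u v w x y z : E
      c d e f : Fin r

  open import Data.List.Membership.DecPropositional (_≟_ {m H}) using (_∈?_)

  infix 4 _∼[_]_

  _∼[_]_ : E → Fin r → E → Set
  x ∼[ c ] y = x ≢ y × edge H x c ≡ edge H y c

  ∼-sym : x ∼[ c ] y → y ∼[ c ] x
  ∼-sym (x≢y , eq) = ≢-sym x≢y , sym eq

  ∼-via : x ∼[ c ] y → x ∼[ c ] z → y ≢ z → y ∼[ c ] z
  ∼-via (_ , p) (_ , q) y≢z = y≢z , trans (sym p) q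

  edge-colour : edge H x c ≡ edge H y d → c ≡ d
  edge-colour {x} {c} {y} {d} eq =
    trans (sym (edge-part H x c)) (trans (cong (part H) eq) (edge-part H y d))

  -- By linearity the two shared vertices coincide, and a vertex lies in only one part.
  colour-unique : x ∼[ c ] y → x ∼[ d ] y → c ≡ d
  colour-unique {x} {c} {y} {d} (x≢y , p) (_ , q) = edge-colour
    (linear x y x≢y (edge H x c) (edge H x d) (c , refl) (c , sym p) (d , refl) (d , sym q))

  -- Vertex `i` of the cycle is where `A i` meets its predecessor. Hence the step from
  -- `A (inject₁ i)` has colour `c (suc i)`, and `c zero` belongs to the closing adjacency.
  rainbowCycle : (A : Fin (suc k) → E) (c : Fin (suc k) → Fin r) →
    Injective _≡_ _≡_ A → Injective _≡_ _≡_ c →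
    (∀ i → A (inject₁ i) ∼[ c (suc i) ] A (suc i)) → A (fromℕ k) ∼[ c zero ] A zero →
    RainbowCycle H k
  rainbowCycle {k} A c A-inj c-inj steps close = record
    { vtx          = λ i → edge H (A i) (c i)
    ; edg          = A
    ; vtx-distinct = c-inj ∘ edge-colour
    ; edg-distinct = A-inj
    ; step₁        = λ i → c (inject₁ i) , refl
    ; step₂        = λ i → c (suc i) , proj₂ (steps i)
    ; close₁       = c (fromℕ k) , refl
    ; close₂       = c zero , proj₂ close
    ; rainbow      = λ {i} {j} eq →
        c-inj (trans (sym (edge-part H (A i) (c i))) (trans eq (edge-part H (A j) (c j))))
    }

  no-rainbow-triangle : x ∼[ c ] y → y ∼[ d ] z → z ∼[ e ] x → c ≢ d → d ≢ e → e ≢ c → ⊥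
  no-rainbow-triangle {x} {c} {y} {d} {z} {e} xy yz zx c≢d d≢e e≢c = no3 (rainbowCycle
    (lookup (x ∷ y ∷ z ∷ [])) (lookup (e ∷ c ∷ d ∷ []))
    (Unique-lookup-injective
      ((proj₁ xy ∷ ≢-sym (proj₁ zx) ∷ []) ∷ (proj₁ yz ∷ []) ∷ [] ∷ []))
    (Unique-lookup-injective ((e≢c ∷ ≢-sym d≢e ∷ []) ∷ (c≢d ∷ []) ∷ [] ∷ []))
    (λ { zero → xy ; (suc zero) → yz }) zx)

  no-rainbow-quadrangle : x ∼[ c ] y → y ∼[ d ] z → z ∼[ e ] w → w ∼[ f ] x → x ≢ z → y ≢ w →
    ¬ Unique (f ∷ c ∷ d ∷ e ∷ [])
  no-rainbow-quadrangle {x} {c} {y} {d} {z} {e} {w} {f} xy yz zw wx x≢z y≢w cs! = no4 (rainbowCycle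
    (lookup (x ∷ y ∷ z ∷ w ∷ [])) (lookup (f ∷ c ∷ d ∷ e ∷ []))
    (Unique-lookup-injective
      ((proj₁ xy ∷ x≢z ∷ ≢-sym (proj₁ wx) ∷ []) ∷ (proj₁ yz ∷ y≢w ∷ []) ∷ (proj₁ zw ∷ []) ∷ [] ∷ []))
    (Unique-lookup-injective cs!)
    (λ { zero → xy ; (suc zero) → yz ; (suc (suc zero)) → zw }) wx)

  -- If `e` is `c` or `d`, sharing a vertex is passed on, and `x` meets one of the two edges in both
  -- colours; otherwise `x`, `a`, `b` form a rainbow triangle.
  fork : x ∼[ c ] a → x ∼[ d ] b → c ≢ d → ¬ a ∼[ e ] b
  fork {c = c} {d = d} {e = e} xa xb c≢d ab with e ≟ c | e ≟ d
  ... | yes refl | _        = c≢d (colour-unique (∼-via (∼-sym xa) ab (proj₁ xb)) xb)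
  ... | no _     | yes refl = c≢d (colour-unique xa (∼-via (∼-sym xb) (∼-sym ab) (proj₁ xa)))
  ... | no e≢c   | no e≢d   = no-rainbow-triangle xa ab (∼-sym xb) (≢-sym e≢c) e≢d (≢-sym c≢d)

  _∼[_]?_ : ∀ x c y → Dec (x ∼[ c ] y)
  x ∼[ c ]? y = ¬? (x ≟ y) ×-dec (edge H x c ≟ edge H y c)

  -- Degrees, unions and deletion of edges

  HasNbr : List E → E → Fin r → Set
  HasNbr L x c = Any (x ∼[ c ]_) L

  hasNbr? : ∀ L x → Decidable (HasNbr L x)
  hasNbr? L x c = Any.any? (x ∼[ c ]?_) L

  colours : List E → E → List (Fin r)
  colours L x = filter (hasNbr? L x) (allFin r)

  deg : List E → E → ℕ
  deg L x = length (colours L x)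

  colours-unique : ∀ L x → Unique (colours L x)
  colours-unique L x = Uniqueₚ.filter⁺ (hasNbr? L x) (Uniqueₚ.allFin⁺ r)

  ∈-colours⁺ : HasNbr L x c → c ∈ colours L x
  ∈-colours⁺ {L} {x} {c} = ∈-filter⁺ (hasNbr? L x) (∈-allFin c)

  ∈-colours⁻ : ∀ L x → c ∈ colours L x → HasNbr L x c
  ∈-colours⁻ L x = proj₂ ∘ ∈-filter⁻ (hasNbr? L x) {xs = allFin r}

  -- No edge is its own neighbour, so `x` itself is exempt from the inclusion; this allows `L′` to
  -- be `L` without `x`.
  deg-mono : (∀ {y} → y ∈ L → x ≢ y → y ∈ L′) → deg L x ≤ deg L′ x
  deg-mono {L} {x} {L′} sub = Unique-⊆-length _≟_ (colours-unique L x) λ c∈ →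
    let y , y∈ , xy = find (∈-colours⁻ L x c∈) in ∈-colours⁺ (lose (sub y∈ (proj₁ xy)) xy)

  Covered : List E → V → Set
  Covered L p = Any (λ e → ∃ λ k → edge H e k ≡ p) L

  covered? : ∀ L → Decidable (Covered L)
  covered? L p = Any.any? (λ e → any? λ k → edge H e k ≟ p) L

  union : List E → List V
  union L = filter (covered? L) (allFin (n H))

  union-unique : ∀ L → Unique (union L)
  union-unique L = Uniqueₚ.filter⁺ (covered? L) (Uniqueₚ.allFin⁺ (n H))

  ∈-union⁺ : ∀ {p} → Covered L p → p ∈ union L
  ∈-union⁺ {L} {p} = ∈-filter⁺ (covered? L) (∈-allFin p)

  ∈-union⁻ : ∀ L {p} → p ∈ union L → Covered L p
  ∈-union⁻ L = proj₂ ∘ ∈-filter⁻ (covered? L) {xs = allFin (n H)}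

  union-mono : L ⊆ L′ → length (union L) ≤ length (union L′)
  union-mono {L} sub = Unique-⊆-length _≟_ (union-unique L) λ p∈ →
    let e , e∈ , e∋p = find (∈-union⁻ L p∈) in ∈-union⁺ (lose (sub e∈) e∋p)

  -- Each colour in which `x` has no neighbour in `L` contributes a new vertex, and only `deg L x`
  -- of the `r` colours are of the other kind.
  union-∷ : x ∉ L → r + length (union L) ≤ length (union (x ∷ L)) + deg L x
  union-∷ {x} {L} x∉L = begin
    r + length (union L)                             ≤⟨ +-monoˡ-≤ _ split ⟩
    (deg L x + length free) + length (union L)       ≡⟨ rearrange (deg L x) (length free) _ ⟩
    (length (union L) + length free) + deg L x       ≤⟨ +-monoˡ-≤ _ new ⟩
    length (union (x ∷ L)) + deg L x                 ∎
    where
    open ≤-Reasoning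
    rearrange : ∀ p q s → (p + q) + s ≡ (s + q) + p
    rearrange = solve-∀
    free? : Decidable (∁ (HasNbr L x))
    free? c = ¬? (hasNbr? L x c)
    free = filter free? (allFin r)
    split : r ≤ deg L x + length free
    split = begin
      r                                ≡⟨ sym (length-tabulate id) ⟩
      length (allFin r)                ≤⟨ Unique-⊆-length _≟_ (Uniqueₚ.allFin⁺ r) sub ⟩
      length (colours L x ++ free)     ≡⟨ length-++ (colours L x) ⟩
      deg L x + length free            ∎
      where
      sub : allFin r ⊆ colours L x ++ free
      sub {c} _ with hasNbr? L x c
      ... | yes p = ∈-++⁺ˡ (∈-colours⁺ p)
      ... | no ¬p = ∈-++⁺ʳ (colours L x) (∈-filter⁺ free? (∈-allFin c) ¬p)
    fresh = map (edge H x) free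
    disjoint : Disjoint (union L) fresh
    disjoint (p∈ , p∈′)
      -- A member of `L` through the vertex of `x` in part `c` meets `x` in that same part, so `c`
      -- would not be free.
      with find (∈-union⁻ L p∈) | ∈-map⁻ (edge H x) p∈′
    ... | e , e∈ , (k , ek) | c , c∈ , refl with refl ← edge-colour ek =
      proj₂ (∈-filter⁻ free? {xs = allFin r} c∈)
        (lose e∈ ((λ { refl → x∉L e∈ }) , sym ek))
    new : length (union L) + length free ≤ length (union (x ∷ L))
    new = begin
      length (union L) + length free     ≡⟨ cong (length (union L) +_) (sym (length-map (edge H x) free)) ⟩
      length (union L) + length fresh    ≡⟨ sym (length-++ (union L)) ⟩
      length (union L ++ fresh)
        ≤⟨ Unique-⊆-length _≟_
             (Uniqueₚ.++⁺ (union-unique L)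
               (Uniqueₚ.map⁺ edge-colour (Uniqueₚ.filter⁺ free? (Uniqueₚ.allFin⁺ r))) disjoint)
             (λ p∈ → sub (∈-++⁻ (union L) p∈)) ⟩
      length (union (x ∷ L))             ∎
      where
      sub : ∀ {p} → p ∈ union L ⊎ p ∈ fresh → p ∈ union (x ∷ L)
      sub (inj₁ p∈) = ∈-union⁺ (there (∈-union⁻ L p∈))
      sub (inj₂ p∈) with c , _ , refl ← ∈-map⁻ (edge H x) p∈ = ∈-union⁺ (here (c , refl))

  -- The overlap |L| r - |⋃ L| is at most `b`, written without truncated subtraction.
  Bound : List E → ℕ → Set
  Bound L b = length L * r ≤ length (union L) + b

  Bounds : ℕ → ℕ → Set
  Bounds k b = ∀ {L} → Unique L → length L ≤ k → Bound L b

  Bound-∷ : ∀ {j b} → x ∉ L → deg L x ≤ j → Bound L b → Bound (x ∷ L) (j + b)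
  Bound-∷ {x} {L} {j} {b} x∉L deg≤ bound = begin
    r + length L * r                              ≤⟨ +-monoʳ-≤ r bound ⟩
    r + (length (union L) + b)                    ≡⟨ sym (+-assoc r _ b) ⟩
    (r + length (union L)) + b                    ≤⟨ +-monoˡ-≤ b (union-∷ x∉L) ⟩
    (length (union (x ∷ L)) + deg L x) + b        ≤⟨ +-monoˡ-≤ b (+-monoʳ-≤ _ deg≤) ⟩
    (length (union (x ∷ L)) + j) + b              ≡⟨ +-assoc _ j b ⟩
    length (union (x ∷ L)) + (j + b)              ∎
    where open ≤-Reasoning

  -- Mutual inclusion stands in for permutation when deleted edges are moved to the front.
  Bound-resp : ∀ {b} → Unique L → L ⊆ L′ → L′ ⊆ L → Bound L′ b → Bound L b
  Bound-resp L! sub sub′ bound = ≤-trans (*-monoˡ-≤ r (Unique-⊆-length _≟_ L! sub))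
    (≤-trans bound (+-monoˡ-≤ _ (union-mono sub′)))

  delete : E → List E → List E
  delete x = outside _≟_ (x ∷ [])

  module _ (x∈ : x ∈ L) (L! : Unique L) where

    delete-unique : Unique (delete x L)
    delete-unique = Uniqueₚ.filter⁺ _ L!

    delete-length : length L ≤ suc k → length (delete x L) ≤ k
    delete-length len = ≤-pred (≤-trans
      (outside-length _≟_ {x ∷ []} ([] ∷ []) (λ { (here refl) → x∈ }) L!) len)

    Bound-delete : ∀ {j b} → deg L x ≤ j → Bound (delete x L) b → Bound L (j + b)
    Bound-delete deg≤ bound = Bound-resp L!
      (⊆-++-outside _≟_ (x ∷ []))
      (λ { (here refl) → x∈ ; (there z∈) → outside⊆ _≟_ (x ∷ []) z∈ })
      (Bound-∷ (outside-∉ _≟_ (x ∷ []) {L} (here refl))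
        (≤-trans (deg-mono λ y∈ _ → outside⊆ _≟_ (x ∷ []) y∈) deg≤) bound)

  -- Stars and fans

  record Star (L : List E) (x : E) (k : ℕ) : Set where
    field
      colour     : Fin k → Fin r
      tip        : Fin k → E
      colour-inj : Injective _≡_ _≡_ colour
      tip∈       : ∀ i → tip i ∈ L
      spoke      : ∀ i → x ∼[ colour i ] tip i

    hub : List E
    hub = x ∷ tabulate tip

    spokes-distinct : ∀ {i j} → i ≢ j → colour i ≢ colour j
    spokes-distinct i≢j = i≢j ∘ colour-inj

    tip-inj : Injective _≡_ _≡_ tip
    tip-inj {i} {j} eq = colour-inj
      (colour-unique (spoke i) (subst (x ∼[ colour j ]_) (sym eq) (spoke j)))

    hub-unique : Unique hub
    hub-unique = ∉⇒Unique-∷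
      (λ x∈ → let i , eq = ∈-tabulate⁻ x∈ in proj₁ (spoke i) eq)
      (Uniqueₚ.tabulate⁺ tip-inj)

    hub⊆ : x ∈ L → hub ⊆ L
    hub⊆ x∈ (here refl) = x∈
    hub⊆ x∈ (there y∈) with i , refl ← ∈-tabulate⁻ y∈ = tip∈ i

    -- The centre meets `tip i` only in the colour of the spoke, and `fork` separates two tips.
    beyond : ∀ i → d ≢ colour i → tip i ∼[ d ] y → y ∉ hub
    beyond i d≢ ty (here refl) = d≢ (colour-unique ty (∼-sym (spoke i)))
    beyond i d≢ ty (there y∈) with j , refl ← ∈-tabulate⁻ y∈ | i ≟ j
    ... | yes refl = proj₁ ty refl
    ... | no  i≢j  = fork (spoke i) (spoke j) (spokes-distinct i≢j) ty

  abstract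
    star : k ≤ deg L x → Star L x k
    star {k} {L} {x} k≤ = record
      { colour     = colour
      ; tip        = λ i → proj₁ (nbr i)
      ; colour-inj = inject≤-injective k≤ k≤ _ _ ∘ Unique-lookup-injective (colours-unique L x)
      ; tip∈       = λ i → proj₁ (proj₂ (nbr i))
      ; spoke      = λ i → proj₂ (proj₂ (nbr i))
      }
      where
      colour : Fin k → Fin r
      colour i = lookup (colours L x) (inject≤ i k≤)
      nbr : ∀ i → ∃ λ y → y ∈ L × x ∼[ colour i ] y
      nbr i = find (∈-colours⁻ L x (∈-lookup (inject≤ i k≤)))

  -- One neighbour is picked per colour; the picks differ because a neighbour determines its colour.
  tips : ∀ (cs : List (Fin r)) → Unique cs → (∀ {c} → c ∈ cs → HasNbr L x c) →
    ∃ λ ys → Unique ys × (∀ {y} → y ∈ ys → y ∈ L × ∃ λ c → c ∈ cs × x ∼[ c ] y) ×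
             length ys ≡ length cs
  tips [] _ _ = [] , [] , (λ ()) , refl
  tips {L} {x} (c ∷ cs) (c∉ ∷ cs!) nbr
    with ys , ys! , ys∈ , len ← tips cs cs! (nbr ∘ there) | y , y∈ , xy ← find (nbr (here refl)) =
    y ∷ ys ,
    ∉⇒Unique-∷ (λ y∈ys → let _ , d , d∈ , xy′ = ys∈ y∈ys in
      All¬⇒¬Any c∉ (subst (_∈ cs) (colour-unique xy′ xy) d∈)) ys! ,
    (λ { (here refl) → y∈ , c , here refl , xy
       ; (there z∈)  → let z∈L , d , d∈ , xz = ys∈ z∈ in z∈L , d , there d∈ , xz }) ,
    cong suc len

  abstract
    -- Leaving out the single colour `c` costs at most one neighbour, whence the `suc`. Here `c` is
    -- a colour already accounted for: that of a class or of a spoke.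
    fan : ∀ L x c → ∃ λ ys → Unique ys ×
      (∀ {y} → y ∈ ys → y ∈ L × ∃ λ d → d ≢ c × x ∼[ d ] y) × deg L x ≤ suc (length ys)
    fan L x c
      with ys , ys! , ys∈ , len ← tips (outside _≟_ (c ∷ []) (colours L x))
             (Uniqueₚ.filter⁺ _ (colours-unique L x))
             (∈-colours⁻ L x ∘ outside⊆ _≟_ (c ∷ [])) =
      ys , ys! ,
      (λ y∈ → let y∈L , d , d∈ , xy = ys∈ y∈ in
        y∈L , d , (λ d≡c → outside-∉ _≟_ (c ∷ []) {colours L x} (here d≡c) d∈) , xy) ,
      ≤-trans (Unique-⊆-length _≟_ (colours-unique L x) (⊆-++-outside _≟_ (c ∷ [])))
        (≤-reflexive (cong suc (sym len)))

  -- Colour classes and minimum degree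

  Over : Fin r → E → E → Set
  Over c u y = u ≡ y ⊎ ∃ λ d → d ≢ c × u ∼[ d ] y

  -- A common member is `u` or `v`, giving this pair a second colour, or a third edge, which
  -- contradicts `fork` at `u`.
  Over-disjoint : u ∼[ c ] v → Over c u y → ¬ Over c v y
  Over-disjoint uv (inj₁ refl) (inj₁ refl) = proj₁ uv refl
  Over-disjoint uv (inj₁ refl) (inj₂ (d , d≢c , vu)) = d≢c (colour-unique (∼-sym vu) uv)
  Over-disjoint uv (inj₂ (d , d≢c , uv′)) (inj₁ refl) = d≢c (colour-unique uv′ uv)
  Over-disjoint uv (inj₂ (d , d≢c , uy)) (inj₂ (e , _ , vy)) = fork uv uy (≢-sym d≢c) vy

  -- The members of a colour class have pairwise disjoint neighbourhoods outside it.
  class-bound : ∀ {j} C → AllPairs (_∼[ c ]_) C → All (λ u → u ∈ L × suc j ≤ deg L u) C →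
    length C * suc j ≤ length L
  class-bound {c} {L} {j} C C∼ C-deg =
    let ys , ys! , ys∈ , len = collect C C∼ C-deg in
    ≤-trans len (Unique-⊆-length _≟_ ys! (proj₁ ∘ ys∈))
    where
    collect : ∀ C → AllPairs (_∼[ c ]_) C → All (λ u → u ∈ L × suc j ≤ deg L u) C →
      ∃ λ ys → Unique ys × (∀ {y} → y ∈ ys → y ∈ L × ∃ λ u → u ∈ C × Over c u y) ×
               length C * suc j ≤ length ys
    collect [] _ _ = [] , [] , (λ ()) , z≤n
    collect (u ∷ C) (u∼ ∷ C∼) ((u∈ , j<) ∷ C-deg)
      with ys , ys! , ys∈ , len ← collect C C∼ C-deg | zs , zs! , zs∈ , len′ ← fan L u c =
      (u ∷ zs) ++ ys ,
      Uniqueₚ.++⁺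
        (∉⇒Unique-∷ (λ u∈zs → let _ , _ , _ , uu = zs∈ u∈zs in proj₁ uu refl) zs!) ys!
        (λ (y∈ , y∈′) → let _ , v , v∈ , vy = ys∈ y∈′ in
          Over-disjoint (All.lookup u∼ v∈) (proj₂ (own y∈)) vy) ,
      (λ y∈ → locate (∈-++⁻ (u ∷ zs) y∈)) ,
      ≤-trans (+-mono-≤ (≤-trans j< len′) len) (≤-reflexive (sym (length-++ (u ∷ zs))))
      where
      own : ∀ {y} → y ∈ u ∷ zs → y ∈ L × Over c u y
      own (here refl) = u∈ , inj₁ refl
      own (there y∈)  = let y∈L , nbr = zs∈ y∈ in y∈L , inj₂ nbr
      locate : ∀ {y} → y ∈ u ∷ zs ⊎ y ∈ ys → y ∈ L × ∃ λ v → v ∈ u ∷ C × Over c v y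
      locate (inj₁ y∈) = let y∈L , uy = own y∈ in y∈L , u , here refl , uy
      locate (inj₂ y∈) = let y∈L , v , v∈ , vy = ys∈ y∈ in y∈L , v , there v∈ , vy

  low-degree? : ∀ L j → (∃ λ x → x ∈ L × deg L x ≤ j) ⊎ (∀ {x} → x ∈ L → j < deg L x)
  low-degree? L j with Any.any? (λ x → deg L x ≤? j) L
  ... | yes p = inj₁ (find p)
  ... | no ¬p = inj₂ (λ x∈ → ≰⇒> (All.lookup (¬Any⇒All¬ L ¬p) x∈))

  -- Apply `class-bound` to `x` and one of its neighbours, as part of a colour class.
  min-degree : ∀ {j} → x ∈ L → (∀ {y} → y ∈ L → j < deg L y) → 2 * suc j ≤ length L
  min-degree {x} {L} x∈ high = class-bound (x ∷ tip zero ∷ []) ((spoke zero ∷ []) ∷ [] ∷ [])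
    ((x∈ , high x∈) ∷ (tip∈ zero , high (tip∈ zero)) ∷ [])
    where open Star (star {1} (≤-trans (s≤s z≤n) (high x∈)))

  -- Bounds for up to six edges, and edges attached to K₃,₃

  Bounds-zero : Bounds 0 0
  Bounds-zero {[]} _ _ = z≤n

  -- The numerical condition and `min-degree` provide an edge of degree at most `j`, which is
  -- deleted first.
  Bounds-suc : ∀ {k j b} → suc k < 2 * suc j → Bounds k b → Bounds (suc k) (j + b)
  Bounds-suc _ _ {[]} _ _ = z≤n
  Bounds-suc {j = j} k<  bounds {L@(_ ∷ _)} L! len with low-degree? L j
  ... | inj₁ (x , x∈ , deg≤) = Bound-delete x∈ L! deg≤
          (bounds (delete-unique x∈ L!) (delete-length x∈ L! len))
  ... | inj₂ high = contradiction (≤-trans (min-degree (here refl) high) len) (<⇒≱ k<)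

  -- A deletion costs at most half the number of edges present, rounded down: 1 + 1 + 0 here, then
  -- 2, 2 and 3 for four, five and six edges.
  Bounds-3 : Bounds 3 2
  Bounds-3 = Bounds-suc {j = 1} ≤-refl (Bounds-suc {j = 1} (from-yes (3 ≤? 4))
               (Bounds-suc {j = 0} ≤-refl Bounds-zero))

  Bounds-4 : Bounds 4 4
  Bounds-4 = Bounds-suc {j = 2} (from-yes (5 ≤? 6)) Bounds-3

  Bounds-5 : Bounds 5 6
  Bounds-5 = Bounds-suc {j = 2} ≤-refl Bounds-4

  Bounds-6 : Bounds 6 9
  Bounds-6 = Bounds-suc {j = 3} (from-yes (7 ≤? 8)) Bounds-5

  -- L can only be a properly 3-coloured K₃,₃; two spokes from x end on the same side
  -- of it, and one of the three quadrangles through them is rainbow.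
  no-extension : Unique L → length L ≤ 6 → (∀ {y} → y ∈ L → 2 < deg L y) → x ∉ L →
    ¬ (2 ≤ deg L x)
  no-extension {L} {x} L! len high x∉ 2≤ =
    impossible (clash zero) (clash (suc zero)) (clash (suc (suc zero)))
    where
    module X = Star (star {L = L} {x} 2≤)
    y₀ = X.tip zero
    y₁ = X.tip (suc zero)
    c₀ = X.colour zero
    c₁ = X.colour (suc zero)

    c₀≢c₁ : c₀ ≢ c₁
    c₀≢c₁ = X.spokes-distinct λ ()

    apart : ∀ {e} → ¬ y₀ ∼[ e ] y₁
    apart = fork (X.spoke zero) (X.spoke (suc zero)) c₀≢c₁

    module Y = Star (star {3} {L} {y₀} (high (X.tip∈ zero)))

    y₁∉hub : y₁ ∉ Y.hub
    y₁∉hub (here eq)  = contradiction (X.tip-inj {suc zero} {zero} eq) λ ()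
    y₁∉hub (there y∈) with i , eq ← ∈-tabulate⁻ y∈ =
      apart (subst (y₀ ∼[ Y.colour i ]_) (sym eq) (Y.spoke i))

    -- `Y.tip i` has two neighbours outside its spoke colour, both beyond the hub. If `y₁` were not
    -- among them, these two, `y₁` and the four members of the hub would be seven edges in `L`.
    common : ∀ i → ∃ λ s → s ≢ Y.colour i × Y.tip i ∼[ s ] y₁
    common i with fan L (Y.tip i) (Y.colour i)
    ... | ys , ys! , ys∈ , deg≤ with y₁ ∈? ys
    ...   | yes y₁∈ = proj₂ (ys∈ y₁∈)
    ...   | no  y₁∉ = contradiction
      (begin
        7                            ≤⟨ +-monoʳ-≤ 5 (≤-pred (≤-trans (high (Y.tip∈ i)) deg≤)) ⟩
        5 + length ys                ≤⟨ Unique-⊆-length _≟_ all! (λ z∈ → sub (∈-++⁻ (y₁ ∷ Y.hub) z∈)) ⟩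
        length L                     ≤⟨ len ⟩
        6                            ∎)
      (<⇒≱ ≤-refl)
      where
      open ≤-Reasoning
      all! : Unique ((y₁ ∷ Y.hub) ++ ys)
      all! = Uniqueₚ.++⁺ (∉⇒Unique-∷ y₁∉hub Y.hub-unique) ys! λ where
        (here refl , z∈ys) → y₁∉ z∈ys
        (there z∈ , z∈ys)  → let _ , _ , d≢ , pz = ys∈ z∈ys in Y.beyond i d≢ pz z∈
      sub : ∀ {z} → z ∈ y₁ ∷ Y.hub ⊎ z ∈ ys → z ∈ L
      sub (inj₁ (here refl)) = X.tip∈ (suc zero)
      sub (inj₁ (there z∈))  = Y.hub⊆ (X.tip∈ zero) z∈
      sub (inj₂ z∈)          = proj₁ (ys∈ z∈)

    s : Fin 3 → Fin r
    s i = proj₁ (common i)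

    -- Equal colours would make two tips of `y₀` adjacent through their common vertex with `y₁`.
    s-inj : ∀ {i j} → i ≢ j → s i ≢ s j
    s-inj {i} {j} i≢j eq = fork (Y.spoke i) (Y.spoke j) (Y.spokes-distinct i≢j)
      (∼-via (∼-sym (proj₂ (proj₂ (common i))))
        (subst (y₁ ∼[_] Y.tip j) (sym eq) (∼-sym (proj₂ (proj₂ (common j)))))
        (i≢j ∘ Y.tip-inj))

    x≢tip : ∀ i → x ≢ Y.tip i
    x≢tip i eq = x∉ (subst (_∈ L) (sym eq) (Y.tip∈ i))

    -- The quadrangle `x`, `y₀`, `Y.tip i`, `y₁` is not rainbow. Consecutive colours differ, since
    -- otherwise `fork` fails or `s i` is the spoke colour, so two opposite colours agree.
    clash : ∀ i → c₀ ≡ s i ⊎ c₁ ≡ Y.colour i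
    clash i with c₀ ≟ s i | c₁ ≟ Y.colour i
    ... | yes p   | _       = inj₁ p
    ... | no _    | yes p   = inj₂ p
    ... | no c₀≢s | no c₁≢r = ⊥-elim (no-rainbow-quadrangle
      (X.spoke zero) (Y.spoke i) py₁ (∼-sym (X.spoke (suc zero))) (x≢tip i)
      (λ eq → contradiction (X.tip-inj {zero} {suc zero} eq) λ ())
      ((≢-sym c₀≢c₁ ∷ c₁≢r ∷ c₁≢s ∷ []) ∷ (c₀≢r ∷ c₀≢s ∷ []) ∷ (≢-sym s≢r ∷ []) ∷ [] ∷ []))
      where
      s≢r = proj₁ (proj₂ (common i))
      py₁ = proj₂ (proj₂ (common i))
      c₀≢r : c₀ ≢ Y.colour i
      c₀≢r eq = fork (∼-via (∼-sym (X.spoke zero))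
                       (subst (y₀ ∼[_] Y.tip i) (sym eq) (Y.spoke i)) (x≢tip i))
                     (X.spoke (suc zero)) c₀≢c₁ py₁
      c₁≢s : c₁ ≢ s i
      c₁≢s eq = fork (X.spoke zero)
                     (∼-via (∼-sym (X.spoke (suc zero)))
                       (subst (y₁ ∼[_] Y.tip i) (sym eq) (∼-sym py₁)) (x≢tip i))
                     c₀≢c₁ (Y.spoke i)

    impossible : let C = λ i → c₀ ≡ s i ⊎ c₁ ≡ Y.colour i in
      C zero → C (suc zero) → C (suc (suc zero)) → ⊥
    -- Two of the three indices fall under the same alternative, against the injectivity of `s` or
    -- of the spoke colours.
    impossible (inj₁ p) (inj₁ q) _        = s-inj {zero} {suc zero} (λ ()) (trans (sym p) q)
    impossible (inj₁ p) (inj₂ _) (inj₁ q) = s-inj {zero} {suc (suc zero)} (λ ()) (trans (sym p) q)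
    impossible (inj₂ _) (inj₁ p) (inj₁ q) = s-inj {suc zero} {suc (suc zero)} (λ ()) (trans (sym p) q)
    impossible (inj₂ p) (inj₂ q) _        = Y.spokes-distinct {zero} {suc zero} (λ ()) (trans (sym p) q)
    impossible (inj₂ p) (inj₁ _) (inj₂ q) = Y.spokes-distinct {zero} {suc (suc zero)} (λ ()) (trans (sym p) q)
    impossible (inj₁ _) (inj₂ p) (inj₂ q) = Y.spokes-distinct {suc zero} {suc (suc zero)} (λ ()) (trans (sym p) q)

  -- At most eight edges, all of degree at least three

  module HighDegree (L! : Unique L) (len : length L ≤ 8) (high : ∀ {x} → x ∈ L → 2 < deg L x) where

    -- Three members of a colour class would by `class-bound` require 3 · 3 = 9 edges.
    thin : x ∈ L → y ∈ L → z ∈ L → x ∼[ c ] y → x ∼[ c ] z → y ≡ z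
    thin {x} {y} {z} x∈ y∈ z∈ xy xz with y ≟ z
    ... | yes y≡z = y≡z
    ... | no  y≢z = contradiction
      (≤-trans (class-bound (x ∷ y ∷ z ∷ []) ((xy ∷ xz ∷ []) ∷ (∼-via xy xz y≢z ∷ []) ∷ [] ∷ [])
        ((x∈ , high x∈) ∷ (y∈ , high y∈) ∷ (z∈ , high z∈) ∷ [])) len)
      (<⇒≱ ≤-refl)

    -- By `thin`, `y` is the only neighbour of `x` in colour `c`, so this colour is absent over `R`.
    deg-< : x ∈ L → y ∈ L → R ⊆ L → y ∉ R → x ∼[ c ] y → deg R x < deg (y ∷ R) x
    deg-< {x} {y} {R} {c} x∈ y∈ R⊆ y∉ xy = Unique-⊆-length _≟_
      (∉⇒Unique-∷
        (λ c∈ → let z , z∈ , xz = find (∈-colours⁻ R x c∈) in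
          y∉ (subst (_∈ R) (thin x∈ (R⊆ z∈) y∈ xz xy) z∈))
        (colours-unique R x))
      λ where
        (here refl) → ∈-colours⁺ (here xy)
        (there c∈)  → ∈-colours⁺ (there (∈-colours⁻ R x c∈))

    deg-drop : ∀ {j} → x ∈ L → y ∈ L → R ⊆ L → y ∉ R → x ∼[ c ] y →
      deg (y ∷ R) x ≤ suc j → deg R x ≤ j
    deg-drop x∈ y∈ R⊆ y∉ xy deg≤ = ≤-pred (≤-trans (deg-< x∈ y∈ R⊆ y∉ xy) deg≤)

    -- Consecutive colours of the quadrangle `v`, `a`, `w`, `b` differ, mostly by `thin`; as it is
    -- not rainbow, two opposite colours agree.
    square : ∀ {α β γ δ} → v ∈ L → w ∈ L → a ∈ L → b ∈ L → v ≢ w →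
      v ∼[ α ] a → v ∼[ β ] b → α ≢ β → w ∼[ γ ] a → w ∼[ δ ] b → γ ≡ β ⊎ δ ≡ α
    square {v} {w} {a} {b} {α} {β} {γ} {δ} v∈ w∈ a∈ b∈ v≢w va vb α≢β wa wb
      with γ ≟ β | δ ≟ α
    ... | yes p  | _      = inj₁ p
    ... | no _   | yes p  = inj₂ p
    ... | no γ≢β | no δ≢α = ⊥-elim (no-rainbow-quadrangle va (∼-sym wa) wb (∼-sym vb) v≢w a≢b
      ((≢-sym α≢β ∷ ≢-sym γ≢β ∷ β≢δ ∷ []) ∷ (α≢γ ∷ ≢-sym δ≢α ∷ []) ∷ (γ≢δ ∷ []) ∷ [] ∷ []))
      where
      a≢b : a ≢ b
      a≢b refl = α≢β (colour-unique va vb)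
      α≢γ : α ≢ γ
      α≢γ refl = v≢w (thin a∈ v∈ w∈ (∼-sym va) (∼-sym wa))
      β≢δ : β ≢ δ
      β≢δ refl = v≢w (thin b∈ v∈ w∈ (∼-sym vb) (∼-sym wb))
      γ≢δ : γ ≢ δ
      γ≢δ refl = a≢b (thin w∈ a∈ b∈ wa wb)

    -- No edge of degree four

    module FourSpokes (v∈ : v ∈ L) (S : Star L v 4) where
      open Star S

      square-tips : ∀ {γ δ i j} → i ≢ j → w ∈ L → v ≢ w →
        w ∼[ γ ] tip i → w ∼[ δ ] tip j → γ ≡ colour j ⊎ δ ≡ colour i
      square-tips {i = i} {j} i≢j w∈ v≢w =
        square v∈ w∈ (tip∈ i) (tip∈ j) v≢w (spoke i) (spoke j) (spokes-distinct i≢j)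

      -- Each pair of tips leaves two options by `square`, and inconsistent choices identify two
      -- spoke colours. So the colours at `w` are those of the spokes, rotated one way or the other;
      -- the first two values suffice later.
      cyclic : ∀ {γ₁ γ₂ γ₃ i j l} → i ≢ j → i ≢ l → j ≢ l → w ∈ L → v ≢ w →
        w ∼[ γ₁ ] tip i → w ∼[ γ₂ ] tip j → w ∼[ γ₃ ] tip l →
        (γ₁ ≡ colour j × γ₂ ≡ colour l) ⊎ (γ₁ ≡ colour l × γ₂ ≡ colour i)
      cyclic {i = i} {j} {l} i≢j i≢l j≢l w∈ v≢w wi wj wl
        with square-tips i≢j w∈ v≢w wi wj | square-tips i≢l w∈ v≢w wi wl | square-tips j≢l w∈ v≢w wj wl
      ... | inj₁ p | inj₁ q | _      = ⊥-elim (spokes-distinct j≢l (trans (sym p) q))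
      ... | inj₁ p | inj₂ _ | inj₁ q = inj₁ (p , q)
      ... | inj₁ _ | inj₂ p | inj₂ q = ⊥-elim (spokes-distinct i≢j (trans (sym p) q))
      ... | inj₂ p | inj₁ q | _      = inj₂ (q , p)
      ... | inj₂ p | inj₂ _ | inj₁ q = ⊥-elim (spokes-distinct i≢l (trans (sym p) q))
      ... | inj₂ _ | inj₂ p | inj₂ q = ⊥-elim (spokes-distinct i≢j (trans (sym p) q))

      Linked : E → Fin 4 → Set
      Linked w i = ∃ λ d → w ∼[ d ] tip i

      -- The triples `i`, `j`, `p` and `i`, `j`, `q` prescribe incompatible colours at tips `i` and
      -- `j`.
      not-all-linked : ∀ {i j p q} → i ≢ j → i ≢ p × i ≢ q → j ≢ p × j ≢ q → p ≢ q → w ∈ L → v ≢ w →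
        Linked w i → Linked w j → Linked w p → ¬ Linked w q
      not-all-linked i≢j (i≢p , i≢q) (j≢p , j≢q) p≢q w∈ v≢w (_ , wi) (_ , wj) (_ , wp) (_ , wq)
        with cyclic i≢j i≢p j≢p w∈ v≢w wi wj wp | cyclic i≢j i≢q j≢q w∈ v≢w wi wj wq
      ... | inj₁ (_ , e₁) | inj₁ (_ , e₂) = spokes-distinct p≢q (trans (sym e₁) e₂)
      ... | inj₁ (e₁ , _) | inj₂ (e₂ , _) = spokes-distinct j≢q (trans (sym e₁) e₂)
      ... | inj₂ (e₁ , _) | inj₁ (e₂ , _) = spokes-distinct j≢p (trans (sym e₂) e₁)
      ... | inj₂ (e₁ , _) | inj₂ (e₂ , _) = spokes-distinct p≢q (trans (sym e₁) e₂)

      -- If both rotations go the same way, `w` and `z` meet one tip in the same colour, against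
      -- `thin`. If they are opposite, the quadrangle `w`, `tip i`, `z`, `tip j` violates `square`.
      not-linked-across : ∀ {i j p q} → i ≢ j → i ≢ p × i ≢ q → j ≢ p × j ≢ q → p ≢ q →
        w ∈ L → v ≢ w → z ∈ L → v ≢ z → w ≢ z →
        Linked w i → Linked w j → Linked w p → Linked z i → Linked z j → ¬ Linked z q
      not-linked-across {i = i} {j} i≢j (i≢p , i≢q) (j≢p , j≢q) p≢q w∈ v≢w z∈ v≢z w≢z
        (_ , wi) (_ , wj) (_ , wp) (_ , zi) (_ , zj) (_ , zq)
        with cyclic i≢j i≢p j≢p w∈ v≢w wi wj wp | cyclic i≢j i≢q j≢q z∈ v≢z zi zj zq
      ... | inj₁ (refl , refl) | inj₁ (refl , refl) =
        w≢z (thin (tip∈ i) w∈ z∈ (∼-sym wi) (∼-sym zi))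
      ... | inj₂ (refl , refl) | inj₂ (refl , refl) =
        w≢z (thin (tip∈ j) w∈ z∈ (∼-sym wj) (∼-sym zj))
      ... | inj₁ (refl , refl) | inj₂ (refl , refl)
        with square w∈ z∈ (tip∈ i) (tip∈ j) w≢z wi wj (spokes-distinct j≢p) zi zj
      ...   | inj₁ eq = spokes-distinct p≢q (sym eq)
      ...   | inj₂ eq = spokes-distinct i≢j eq
      not-linked-across {i = i} {j} i≢j (i≢p , i≢q) (j≢p , j≢q) p≢q w∈ v≢w z∈ v≢z w≢z
        (_ , wi) (_ , wj) (_ , wp) (_ , zi) (_ , zj) (_ , zq)
          | inj₂ (refl , refl) | inj₁ (refl , refl)
        with square w∈ z∈ (tip∈ i) (tip∈ j) w≢z wi wj (≢-sym (spokes-distinct i≢p)) zi zj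
      ...   | inj₁ eq = spokes-distinct i≢j (sym eq)
      ...   | inj₂ eq = spokes-distinct p≢q (sym eq)

      module _ (W : Fin 3 → E) (W-index : ∀ {w} → w ∈ L → w ∉ hub → ∃ λ j → W j ≡ w) where

        -- Membership and distinctness from `v` are recorded because a surplus index of `W` may give
        -- the default `v`.
        Near : Fin 3 → Fin 4 → Set
        Near j i = W j ∈ L × v ≢ W j × Linked (W j) i

        -- Tip i has two neighbours W s and W t; it may miss the third value W u.
        record Misses (i : Fin 4) (u : Fin 3) : Set where
          field
            s t : Fin 3
            W-≢ : W s ≢ W t
            s≢u : s ≢ u
            t≢u : t ≢ u
            hit : ∀ j → j ≢ u → Near j i

        -- Outside its spoke colour, tip `i` has two neighbours; they lie beyond the hub and so are
        -- values of `W`. The index left over by `complement` is the missed one.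
        misses : ∀ i → ∃ (Misses i)
        misses i with fan L (tip i) (colour i)
        ... | [] , _ , _ , deg≤ = contradiction (≤-trans (high (tip∈ i)) deg≤) λ { (s≤s ()) }
        ... | _ ∷ [] , _ , _ , deg≤ = contradiction (≤-trans (high (tip∈ i)) deg≤) λ { (s≤s (s≤s ())) }
        ... | y ∷ z ∷ _ , (y≢z ∷ _) ∷ _ , ys∈ , _ = build (locate (here refl)) (locate (there (here refl)))
          where
          locate : ∀ {y} → y ∈ _ → ∃ λ j → W j ≡ y × Near j i
          locate y∈ with y∈L , d , d≢ , ty ← ys∈ y∈
            with j , refl ← W-index y∈L (beyond i d≢ ty) =
            j , refl , y∈L , (λ eq → beyond i d≢ ty (here (sym eq))) , d , ∼-sym ty
          build : (∃ λ j → W j ≡ y × Near j i) → (∃ λ j → W j ≡ z × Near j i) → ∃ (Misses i)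
          build (s , refl , near-s) (t , refl , near-t)
            with u , s≢u , t≢u , rest ← complement s t (λ eq → y≢z (cong W eq)) = u , record
            { s = s ; t = t ; W-≢ = y≢z ; s≢u = s≢u ; t≢u = t≢u
            ; hit = λ j j≢u → near (rest j j≢u) }
            where
            near : ∀ {j} → j ≡ s ⊎ j ≡ t → Near j i
            near (inj₁ refl) = near-s
            near (inj₂ refl) = near-t

        near-either : ∀ {i u s t} → Misses i u → s ≢ t → Near s i ⊎ Near t i
        near-either {u = u} {s} {t} M s≢t with s ≟ u
        ... | yes refl = inj₂ (Misses.hit M t (≢-sym s≢t))
        ... | no s≢u   = inj₁ (Misses.hit M s s≢u)

        -- Two of the four tips miss the same index, so both are linked to `W s` and `W t`. Each of
        -- the other two tips is linked to one of these: the same one contradicts `not-all-linked`,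
        -- different ones `not-linked-across`.
        impossible : ⊥
        impossible with i , j , i<j , eq ← pigeonhole {3} {4} ≤-refl (proj₁ ∘ misses)
          with p , q , i≢ , j≢ , p≢q ← other-two i j =
          cases (near-either (proj₂ (misses p)) s≢t) (near-either (proj₂ (misses q)) s≢t)
          where
          open Misses (proj₂ (misses i))
          module J = Misses (subst (Misses j) (sym eq) (proj₂ (misses j)))
          s≢t : s ≢ t
          s≢t = W-≢ ∘ cong W
          i≢j : i ≢ j
          i≢j = <⇒≢ i<j
          s∈ = proj₁ (hit s s≢u)
          t∈ = proj₁ (hit t t≢u)
          v≢s = proj₁ (proj₂ (hit s s≢u))
          v≢t = proj₁ (proj₂ (hit t t≢u))
          link : ∀ {j i} → Near j i → Linked (W j) i
          link = proj₂ ∘ proj₂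
          si = link (hit s s≢u)
          ti = link (hit t t≢u)
          sj = link (J.hit s s≢u)
          tj = link (J.hit t t≢u)
          cases : Near s p ⊎ Near t p → Near s q ⊎ Near t q → ⊥
          cases (inj₁ sp) (inj₁ sq) = not-all-linked i≢j i≢ j≢ p≢q s∈ v≢s si sj (link sp) (link sq)
          cases (inj₂ tp) (inj₂ tq) = not-all-linked i≢j i≢ j≢ p≢q t∈ v≢t ti tj (link tp) (link tq)
          cases (inj₁ sp) (inj₂ tq) =
            not-linked-across i≢j i≢ j≢ p≢q s∈ v≢s t∈ v≢t W-≢ si sj (link sp) ti tj (link tq)
          cases (inj₂ tp) (inj₁ sq) =
            not-linked-across i≢j i≢ j≢ p≢q t∈ v≢t s∈ v≢s (≢-sym W-≢) ti tj (link tp) si sj (link sq)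

      far : List E
      far = outside _≟_ hub L

      far-length : length far ≤ 3
      far-length = +-cancelˡ-≤ 5 _ _ (≤-trans (outside-length _≟_ hub-unique (hub⊆ v∈) L!) len)

      contradictory : ⊥
      contradictory = let W , W-index = covering v far far-length in
        impossible W (λ w∈ w∉ → W-index (∈-outside _≟_ hub w∈ w∉))

    -- Quadrangles and their deletion

    cubic : x ∈ L → deg L x ≤ 3
    cubic {x} x∈ with deg L x ≤? 3
    ... | yes p = p
    ... | no ¬p = ⊥-elim (FourSpokes.contradictory x∈ (star (≰⇒> ¬p)))

    deg-≤3 : x ∈ L → R ⊆ L → deg R x ≤ 3
    deg-≤3 x∈ R⊆ = ≤-trans (deg-mono λ y∈ _ → R⊆ y∈) (cubic x∈)

    record Quadrangle (v a b w : E) : Set where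
      field
        {c₁ c₂ d₁ d₂} : Fin r
        a∈ : a ∈ L
        b∈ : b ∈ L
        w∈ : w ∈ L
        va : v ∼[ c₁ ] a
        vb : v ∼[ c₂ ] b
        aw : a ∼[ d₁ ] w
        bw : b ∼[ d₂ ] w
        v≢w : v ≢ w
        a≢b : a ≢ b

    module _ (v∈ : v ∈ L) where
      private
        open Star (star {3} (high v∈))

        F : Fin 3 → List E
        F i = proj₁ (fan L (tip i) (colour i))

        F! : ∀ i → Unique (F i)
        F! i = proj₁ (proj₂ (fan L (tip i) (colour i)))

        F∈ : ∀ i → y ∈ F i → y ∈ L × ∃ λ d → d ≢ colour i × tip i ∼[ d ] y
        F∈ i = proj₁ (proj₂ (proj₂ (fan L (tip i) (colour i))))

        F≥ : ∀ i → 2 ≤ length (F i)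
        F≥ i = ≤-pred (≤-trans (high (tip∈ i)) (proj₂ (proj₂ (proj₂ (fan L (tip i) (colour i))))))

        ΣF : List E
        ΣF = F zero ++ F (suc zero) ++ F (suc (suc zero))

        ∈ΣF : y ∈ ΣF → ∃ λ i → y ∈ F i
        ∈ΣF y∈ with ∈-++⁻ (F zero) y∈
        ... | inj₁ y∈₀ = zero , y∈₀
        ... | inj₂ y∈′ with ∈-++⁻ (F (suc zero)) y∈′
        ...   | inj₁ y∈₁ = suc zero , y∈₁
        ...   | inj₂ y∈₂ = suc (suc zero) , y∈₂

        -- Pairwise disjoint fans would add at least six edges to the four of the hub.
        fans-meet : ¬ (∀ {i j} → i ≢ j → Disjoint (F i) (F j))
        fans-meet apart = contradiction
          (begin
            4 + (2 + (2 + 2))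
              ≤⟨ +-monoʳ-≤ 4 (+-mono-≤ (F≥ zero) (+-mono-≤ (F≥ (suc zero)) (F≥ (suc (suc zero))))) ⟩
            4 + (length (F zero) + (length (F (suc zero)) + length (F (suc (suc zero)))))
              ≡⟨ cong (λ l → 4 + (length (F zero) + l)) (sym (length-++ (F (suc zero)))) ⟩
            4 + (length (F zero) + length (F (suc zero) ++ F (suc (suc zero))))
              ≡⟨ cong (4 +_) (sym (length-++ (F zero))) ⟩
            length (hub ++ ΣF)            ≤⟨ Unique-⊆-length _≟_ all! (λ z∈ → sub (∈-++⁻ hub z∈)) ⟩
            length L                      ≤⟨ len ⟩
            8                             ∎)
          (<⇒≱ (from-yes (9 ≤? 10)))
          where
          open ≤-Reasoning
          all! : Unique (hub ++ ΣF)
          all! = Uniqueₚ.++⁺ hub-unique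
            (Uniqueₚ.++⁺ (F! zero)
              (Uniqueₚ.++⁺ (F! (suc zero)) (F! (suc (suc zero))) (apart λ ()))
              λ (z∈ , z∈′) → apart₀ z∈ (∈-++⁻ (F (suc zero)) z∈′))
            (λ (z∈ , z∈′) → let i , z∈F = ∈ΣF z∈′ ; _ , _ , d≢ , tz = F∈ i z∈F in beyond i d≢ tz z∈)
            where
            apart₀ : z ∈ F zero → ¬ (z ∈ F (suc zero) ⊎ z ∈ F (suc (suc zero)))
            apart₀ z∈ (inj₁ z∈₁) = apart {zero} {suc zero} (λ ()) (z∈ , z∈₁)
            apart₀ z∈ (inj₂ z∈₂) = apart {zero} {suc (suc zero)} (λ ()) (z∈ , z∈₂)
          sub : z ∈ hub ⊎ z ∈ ΣF → z ∈ L
          sub (inj₁ z∈) = hub⊆ v∈ z∈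
          sub (inj₂ z∈) = let i , z∈F = ∈ΣF z∈ in proj₁ (F∈ i z∈F)

      -- A common member of the fans of two tips is the corner opposite to `v`; it is not `v`, being
      -- beyond the hub.
      quadrangle : ∃ λ a → ∃ λ b → ∃ λ w → Quadrangle v a b w
      quadrangle with any? (λ i → any? λ j → ¬? (i ≟ j) ×-dec Any.any? (_∈? F j) (F i))
      ... | no ¬meet = ⊥-elim (fans-meet λ {i} {j} i≢j (y∈i , y∈j) → ¬meet (i , j , i≢j , lose y∈i y∈j))
      ... | yes (i , j , i≢j , meet) =
        let w , w∈i , w∈j = find meet
            w∈ , _ , d₁≢ , aw = F∈ i w∈i
            _  , _ , _   , bw = F∈ j w∈j
        in tip i , tip j , w , record
          { a∈ = tip∈ i ; b∈ = tip∈ j ; w∈ = w∈ ; va = spoke i ; vb = spoke j ; aw = aw ; bw = bw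
          ; v≢w = λ eq → beyond i d₁≢ aw (here (sym eq)) ; a≢b = i≢j ∘ tip-inj }

    -- Removing v, a, b, w in this order, their degrees are at most 3, 2, 2, 1.
    Bound-cubic : ∀ {k b} → v ∈ L → length L ≤ 4 + k → Bounds k b → Bound L (8 + b)
    Bound-cubic {v} {k} {β} v∈ len′ bounds with a , b , w , quad ← quadrangle v∈ = Bound-resp L! (⊆-++-outside _≟_ Q) Q++R⊆
      (peel (Uniqueₚ.++⁺ Q! R! λ (∈Q , ∈R) → outside-∉ _≟_ Q {L} ∈Q ∈R))
      where
      open Quadrangle quad
      Q  = v ∷ a ∷ b ∷ w ∷ []
      R₀ = outside _≟_ Q L
      R! : Unique R₀
      R! = Uniqueₚ.filter⁺ _ L!
      Q! : Unique Q
      Q! = (proj₁ va ∷ proj₁ vb ∷ v≢w ∷ []) ∷ (a≢b ∷ proj₁ aw ∷ []) ∷ (proj₁ bw ∷ []) ∷ [] ∷ []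
      R⊆ : R₀ ⊆ L
      R⊆ = outside⊆ _≟_ Q
      wR⊆ : w ∷ R₀ ⊆ L
      wR⊆ = ∈-∷⁺ʳ w∈ R⊆
      bwR⊆ : b ∷ w ∷ R₀ ⊆ L
      bwR⊆ = ∈-∷⁺ʳ b∈ wR⊆
      Q++R⊆ : Q ++ R₀ ⊆ L
      Q++R⊆ = ∈-∷⁺ʳ v∈ (∈-∷⁺ʳ a∈ bwR⊆)
      Q⊆ : Q ⊆ L
      Q⊆ = Q++R⊆ ∘ ∈-++⁺ˡ
      peel : Unique (Q ++ R₀) → Bound (Q ++ R₀) (8 + β)
      peel ((v≢a ∷ v∉bwR@(_ ∷ v∉wR)) ∷ a∉bwR@(_ ∷ _ ∷ a∉R) ∷ b∉wR@(_ ∷ b∉R) ∷ w∉R ∷ _) =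
        Bound-∷ (All¬⇒¬Any (v≢a ∷ v∉bwR)) (deg-≤3 v∈ (∈-∷⁺ʳ a∈ bwR⊆))
        -- Every neighbour removed earlier lowers the degree by one: `a` and `b` have lost `v`, and
        -- `w` has lost both `a` and `b`.
        (Bound-∷ (All¬⇒¬Any a∉bwR)
          (deg-drop a∈ v∈ bwR⊆ (All¬⇒¬Any v∉bwR) (∼-sym va) (deg-≤3 a∈ (∈-∷⁺ʳ v∈ bwR⊆)))
        (Bound-∷ (All¬⇒¬Any b∉wR)
          (deg-drop b∈ v∈ wR⊆ (All¬⇒¬Any v∉wR) (∼-sym vb) (deg-≤3 b∈ (∈-∷⁺ʳ v∈ wR⊆)))
        (Bound-∷ (All¬⇒¬Any w∉R)
          (deg-drop w∈ b∈ R⊆ (All¬⇒¬Any b∉R) (∼-sym bw)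
            (deg-drop w∈ a∈ (∈-∷⁺ʳ b∈ R⊆) (All¬⇒¬Any (a≢b ∷ a∉R)) (∼-sym aw)
              (deg-≤3 w∈ (∈-∷⁺ʳ a∈ (∈-∷⁺ʳ b∈ R⊆)))))
        (bounds R! (+-cancelˡ-≤ 4 _ _ (≤-trans (outside-length _≟_ Q! Q⊆ L!) len′))))))

  -- Seven and eight edges

  -- The budget is met as 1 + 9, as 8 + 2 by removing a quadrangle, or as 2 + 2 + 6. What remains is
  -- an edge of degree two attached to at most six edges that keep degree three among themselves,
  -- which `no-extension` excludes.
  Bounds-7 : Bounds 7 10
  Bounds-7 {[]} _ _ = z≤n
  Bounds-7 {L@(_ ∷ _)} L! len with low-degree? L 1
  ... | inj₁ (x , x∈ , deg≤) = Bound-delete x∈ L! deg≤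
          (Bounds-6 (delete-unique x∈ L!) (delete-length x∈ L! len))
  ... | inj₂ 2≤ with low-degree? L 2
  ...   | inj₂ high = HighDegree.Bound-cubic L! (≤-trans len (from-yes (7 ≤? 8))) high (here refl) len Bounds-3
  ...   | inj₁ (x , x∈ , deg≤) with low-degree? (delete x L) 2
  ...     | inj₁ (y , y∈ , deg≤′) = Bound-delete x∈ L! deg≤ (Bound-delete y∈ L₁! deg≤′
              (Bounds-5 (delete-unique y∈ L₁!) (delete-length y∈ L₁! (delete-length x∈ L! len))))
    where
    L₁! : Unique (delete x L)
    L₁! = delete-unique x∈ L!
  ...     | inj₂ high = ⊥-elim (no-extension (delete-unique x∈ L!) (delete-length x∈ L! len) high
              (outside-∉ _≟_ (x ∷ []) {L} (here refl))
              (≤-trans (2≤ x∈) (deg-mono λ y∈ x≢y →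
                ∈-outside _≟_ (x ∷ []) y∈ λ { (here refl) → x≢y refl })))

  -- Either 2 + 10 after deleting an edge of degree at most two, or 8 + 4 after deleting a
  -- quadrangle.
  Bounds-8 : Bounds 8 12
  Bounds-8 {[]} _ _ = z≤n
  Bounds-8 {L@(_ ∷ _)} L! len with low-degree? L 2
  ... | inj₁ (x , x∈ , deg≤) = Bound-delete x∈ L! deg≤
          (Bounds-7 (delete-unique x∈ L!) (delete-length x∈ L! len))
  ... | inj₂ high = HighDegree.Bound-cubic L! len high (here refl) len Bounds-4

theorem16 : (r : ℕ) → 3 ≤ r → (H : PartiteHypergraph r) → Linear H →
    ¬ HasRainbowCycleOfLength H 3 → ¬ HasRainbowCycleOfLength H 4 →
    GFree H (8 * r ∸ 13) 8
theorem16 r 3≤r H linear no3 no4 S S-inj = begin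
  -- The subtraction is not truncated: 13 ≤ 24 ≤ 8r.
  suc (8 * r ∸ 13)        ≡⟨ sym (+-∸-assoc 1 (≤-trans (from-yes (13 ≤? 24)) (*-monoʳ-≤ 8 3≤r))) ⟩
  8 * r ∸ 12              ≤⟨ m≤n+o⇒m∸n≤o (8 * r) 12 (≤-trans bound (≤-reflexive (+-comm _ 12))) ⟩
  length (union L)        ≤⟨ Unique-⊆-length _≟_ (union-unique L) sub ⟩
  unionSize H S           ∎
  where
  open ≤-Reasoning
  open Conflicts H linear no3 no4
  L : List (Fin (m H))
  L = tabulate S
  bound : Bound L 12
  bound = Bounds-8 (Uniqueₚ.tabulate⁺ S-inj) ≤-refl
  sub : union L ⊆ _
  sub {p} p∈ with e , e∈ , e∋p ← find (∈-union⁻ L p∈) with j , refl ← ∈-tabulate⁻ {f = S} e∈ =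
    ∈-filter⁺ (λ v → any? (λ j → any? (λ k → edge H (S j) k ≟ v))) (∈-allFin p) (j , e∋p)
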